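{- Let $t\ge 2$ be an integer. If $G$ is an induced-subgraph-minimal graph having a pivot-minor isomorphic to $K_{1,t}$, then $|V(G)|\le (t^2-1)(2^{t+1}-t-3)+2t+2$.
   Context: Graphs are finite, without loops or multiple edges. $K_{1,t}$ is the star with $t$ leaves. For a vertex $u$ of a graph $G$, the local complementation $G*u$ is obtained from $G$ by complementing the adjacency between every pair of distinct neighbours of $u$. For an edge $uv$ of $G$, the edge pivot is $G\wedge uv=((G*u)*v)*u$. A graph $G$ contains $H$ as a pivot-minor if $H$ can be obtained from $G$ by a sequence of vertex deletions and edge pivots. A graph $G$ is an induced-subgraph-minimal graph having a pivot-minor isomorphic to $H$ if $G$ has a pivot-minor isomorphic to $H$ but no proper induced subgraph of $G$ does. -}

module Defs where

open import Data.Bool using (Bool; true; false; _∧_; _xor_; not)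
open import Data.Bool.Properties using (∧-comm)
open import Data.Fin using (Fin; zero; suc; punchIn)
open import Data.Fin.Properties using (_≟_; punchIn-injective)
open import Data.Nat using (ℕ; suc; _<_)
open import Data.Product using (_×_; ∃₂)
open import Function.Bundles using (_↔_; _↣_; mk↣; Inverse; Injection)
open import Relation.Binary.PropositionalEquality
  using (_≡_; refl; sym; cong; cong₂)
open import Relation.Nullary using (¬_; yes; no; does; contradiction)

-- A finite simple graph with vertex set Fin n, so that |V(G)| = n.
record Graph (n : ℕ) : Set where
  field
    adj     : Fin n → Fin n → Bool
    adj-sym : ∀ x y → adj x y ≡ adj y x
    adj-irr : ∀ x → adj x x ≡ false

open Graph public

private
  variable
    m n : ℕ

infix 4 _≅_

record _≅_ (G : Graph m) (H : Graph n) : Set where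
  field
    vertices : Fin m ↔ Fin n
    preserve : ∀ x y →
      adj H (Inverse.to vertices x) (Inverse.to vertices y) ≡ adj G x y

-- The subgraph of G induced on the image of f, with its vertices labelled
-- by Fin m through f. Every induced subgraph on m vertices arises this way,
-- and it is proper exactly when m < n.
induced : Graph n → Fin m ↣ Fin n → Graph m
induced G f = record
  { adj     = λ x y → adj G (to x) (to y)
  ; adj-sym = λ x y → adj-sym G (to x) (to y)
  ; adj-irr = λ x → adj-irr G (to x)
  }
  where open Injection f using (to)

deleteVertex : Graph (suc n) → Fin (suc n) → Graph n
deleteVertex G v = induced G (mk↣ (punchIn-injective v _ _))

distinct : Fin n → Fin n → Bool
distinct x y = not (does (x ≟ y))

distinct-sym : (x y : Fin n) → distinct x y ≡ distinct y x
distinct-sym x y with x ≟ y | y ≟ x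
... | yes _ | yes _ = refl
... | no  _ | no  _ = refl
... | yes p | no ¬q = contradiction (sym p) ¬q
... | no ¬p | yes q = contradiction (sym q) ¬p

distinct-irr : (x : Fin n) → distinct x x ≡ false
distinct-irr x with x ≟ x
... | yes _ = refl
... | no ¬p = contradiction refl ¬p

infixl 7 _*_

-- Local complementation: the xor flips exactly the pairs of distinct
-- neighbours of u.
_*_ : Graph n → Fin n → Graph n
G * u = record
  { adj     = λ x y → adj G x y xor (distinct x y ∧ (adj G u x ∧ adj G u y))
  ; adj-sym = λ x y → cong₂ _xor_ (adj-sym G x y)
      (cong₂ _∧_ (distinct-sym x y) (∧-comm (adj G u x) (adj G u y)))
  ; adj-irr = λ x → cong₂ _xor_ (adj-irr G x)
      (cong (_∧ (adj G u x ∧ adj G u x)) (distinct-irr x))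
  }

pivot : Graph n → Fin n → Fin n → Graph n
pivot G u v = ((G * u) * v) * u

data PivotMinor (G : Graph n) : ∀ {m} → Graph m → Set where
  self      : PivotMinor G G
  delete    : {H : Graph (suc m)} → PivotMinor G H →
              (v : Fin (suc m)) → PivotMinor G (deleteVertex H v)
  pivotEdge : {H : Graph m} → PivotMinor G H →
              (u v : Fin m) → adj H u v ≡ true → PivotMinor G (pivot H u v)

HasPivotMinorIsoTo : Graph n → Graph m → Set
HasPivotMinorIsoTo G H = ∃₂ λ k (G′ : Graph k) → PivotMinor G G′ × G′ ≅ H

InducedSubgraphMinimal : Graph n → Graph m → Set
InducedSubgraphMinimal {n} G H =
  HasPivotMinorIsoTo G H ×
  (∀ {k} → k < n → (f : Fin k ↣ Fin n) → ¬ HasPivotMinorIsoTo (induced G f) H)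

-- K_{1,t}; the centre is zero.
star : (t : ℕ) → Graph (suc t)
star t = record { adj = a ; adj-sym = s ; adj-irr = i }
  where
  a : Fin (suc t) → Fin (suc t) → Bool
  a zero    zero    = false
  a zero    (suc _) = true
  a (suc _) zero    = true
  a (suc _) (suc _) = false

  s : ∀ x y → a x y ≡ a y x
  s zero    zero    = refl
  s zero    (suc _) = refl
  s (suc _) zero    = refl
  s (suc _) (suc _) = refl

  i : ∀ x → a x x ≡ false
  i zero    = refl
  i (suc _) = refl

{-# OPTIONS --safe #-}
module Submission where

open import Data.Nat using (ℕ; _+_; _*_; _∸_; _^_; _≤_)
open import Defs using (Graph; star; InducedSubgraphMinimal)

open import Algebra.Bundles using (CommutativeRing)
open import Data.Bool using (Bool; true; false; _∧_; _xor_; not; if_then_else_)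
import Data.Bool.Properties as Bool
open import Data.Bool.Solver using (module xor-∧-Solver)
open import Data.Fin using (Fin; zero; suc; toℕ; punchIn; punchOut; inject≤; funToFin; finToFun)
open import Data.Fin.Properties using (_≟_; any?; all?; toℕ<n; toℕ-injective; punchIn-injective; punchOut-injective; punchIn-punchOut; ¬∀⟶∃¬; inject≤-injective; finToFun-funToFin; 2↔Bool)
open import Data.List using (List; []; _∷_; length; lookup; map; filter; allFin)
open import Data.List.Membership.Propositional.Properties using (∈-lookup)
open import Data.List.Properties using (length-map; length-tabulate; map-id)
open import Data.List.Relation.Unary.All as All using (All; []; _∷_)
import Data.List.Relation.Unary.All.Properties as All
open import Data.List.Relation.Unary.AllPairs using (AllPairs; []; _∷_)
import Data.List.Relation.Unary.AllPairs.Properties as AllPairs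
open import Data.List.Relation.Unary.Unique.Propositional using (Unique)
import Data.List.Relation.Unary.Unique.Propositional.Properties as Unique
open import Data.Nat using (zero; suc; _<_; z≤n; s≤s; s≤s⁻¹)
import Data.Nat.Properties as ℕ
open import Data.Nat.Solver using (module +-*-Solver)
open import Data.Product using (∃; _×_; _,_; proj₁; proj₂)
open import Data.Sum using (_⊎_; inj₁; inj₂)
open import Function.Base using (_∘_)
open import Function.Bundles using (_↣_; mk↣; mk↔ₛ′; Injection; Inverse)
open import Relation.Binary.Definitions using (Symmetric)
open import Relation.Binary.PropositionalEquality
open import Relation.Nullary using (¬_; yes; no; does; contradiction; Dec; ¬?)
open import Relation.Nullary.Decidable using (dec-true; dec-false; _×-dec_)
open import Relation.Unary using (Decidable)
open import Defs hiding (Graph; star; InducedSubgraphMinimal) renaming (_*_ to _⋆_)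

open import Algebra.Properties.Semiring.Sum (CommutativeRing.semiring Bool.xor-∧-commutativeRing) using (sum; sum-cong-≗; ∑-distrib-+; *-distribˡ-sum)

-- Let A be the adjacency matrix of G over GF(2) and let L(G) be the space of
-- pairs (x , A x). Pivoting on an edge uv exchanges the two components at u
-- and at v, so a graph H pivot-equivalent to G has L(G) equal to L(H) with the
-- components exchanged along a vertex set X; conversely, if v ∉ X then H - v is
-- pivot-equivalent to G - v.
--
-- Let G be minimal and choose such an H in which S induces K_{1,t}. Every
-- v ∉ S lies in X, for otherwise G - v would have the star as a pivot-minor. Then
-- v leaves X when H is pivoted on an edge vw, so (H ∧ vw) - v contains no induced
-- K_{1,t}. It follows that:
--  * every v ∉ S has a neighbour in S, and vertices outside S with the same
--    trace on S are nonadjacent;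
--  * two vertices outside S with the same trace are distinguished by some w ∉ S,
--    since the exchange along X leaves no kernel vector of A supported in X;
--  * if w ∉ S has a neighbour v ∉ S with a given trace, and P is an independent
--    set with a common neighbour in S and without neighbours of v, then w has at
--    most t neighbours in P (pivot on w and one of them: the others become its
--    leaves) and at most t - 2 nonneighbours in P (pivot on vw: they form a star
--    together with w).
-- Hence each nonempty trace occurs at most 2t - 2 times, even when each vertex of
-- S is counted with its own singleton, and |V(G)| ≤ (2^(t+1) - 1)(2t - 2).

private
  variable
    k m n t : ℕ
    A B : Set

-- The exchange property of pivots

δ : Fin n → Fin n → Bool
δ u i = does (u ≟ i)

δ-refl : (u : Fin n) → δ u u ≡ true
δ-refl u = dec-true (u ≟ u) refl

δ-≢ : {u i : Fin n} → u ≢ i → δ u i ≡ false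
δ-≢ {u = u} {i} = dec-false (u ≟ i)

sum-false : {f : Fin n → Bool} → (∀ j → f j ≡ false) → sum f ≡ false
sum-false {zero}  f≡0 = refl
sum-false {suc n} f≡0 = cong₂ _xor_ (f≡0 zero) (sum-false (f≡0 ∘ suc))

δ-suc : (u i : Fin n) → δ (suc u) (suc i) ≡ δ u i
δ-suc u i with u ≟ i
... | yes _ = refl
... | no  _ = refl

sum-∧-δ : (f : Fin n → Bool) (u : Fin n) → sum (λ j → f j ∧ δ u j) ≡ f u
sum-∧-δ f zero = trans
  (cong₂ _xor_ (Bool.∧-identityʳ (f zero)) (sum-false (λ j → Bool.∧-zeroʳ (f (suc j)))))
  (Bool.xor-identityʳ (f zero))
sum-∧-δ f (suc u) = cong₂ _xor_ (Bool.∧-zeroʳ (f zero))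
  (trans (sum-cong-≗ (λ j → cong (f (suc j) ∧_) (δ-suc u j))) (sum-∧-δ (f ∘ suc) u))

-- The product A x over GF(2): the ring operations of sum are _xor_ and _∧_.
image : Graph n → (Fin n → Bool) → Fin n → Bool
image G x i = sum (λ j → adj G i j ∧ x j)

image-cong : (G : Graph n) {x y : Fin n → Bool} → x ≗ y → image G x ≗ image G y
image-cong G x≗y i = sum-cong-≗ (λ j → cong (adj G i j ∧_) (x≗y j))

image-false : (G : Graph n) {x : Fin n → Bool} → (∀ i → x i ≡ false) → ∀ i → image G x i ≡ false
image-false G x≡0 i = sum-false (λ j →
  trans (cong (adj G i j ∧_) (x≡0 j)) (Bool.∧-zeroʳ (adj G i j)))

image-δ : (G : Graph n) (u i : Fin n) → image G (δ u) i ≡ adj G i u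
image-δ G u i = sum-∧-δ (adj G i) u

image-xor : (G : Graph n) (x y : Fin n → Bool) (i : Fin n) →
            image G (λ j → x j xor y j) i ≡ image G x i xor image G y i
image-xor G x y i = trans
  (sum-cong-≗ (λ j → Bool.∧-distribˡ-xor (adj G i j) (x j) (y j)))
  (∑-distrib-+ (λ j → adj G i j ∧ x j) (λ j → adj G i j ∧ y j))

image-∧δ : (G : Graph n) (u : Fin n) (b : Bool) (i : Fin n) →
           image G (λ j → δ u j ∧ b) i ≡ adj G i u ∧ b
image-∧δ G u true  i = trans
  (image-cong G (λ j → Bool.∧-identityʳ (δ u j)) i)
  (trans (image-δ G u i) (sym (Bool.∧-identityʳ (adj G i u))))
image-∧δ G u false i = trans
  (image-false G (λ j → Bool.∧-zeroʳ (δ u j)) i)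
  (sym (Bool.∧-zeroʳ (adj G i u)))

-- Over GF(2) local complementation adds the rank-one matrix of the neighbourhood of `u`, except on
-- the diagonal; the term `adj G u i ∧ x i` is that diagonal correction.
image-⋆ : (G : Graph n) (u : Fin n) (x : Fin n → Bool) (i : Fin n) →
          image (G ⋆ u) x i ≡
          image G x i xor ((adj G u i ∧ image G x u) xor (adj G u i ∧ x i))
image-⋆ G u x i = begin
  image (G ⋆ u) x i
    ≡⟨ sum-cong-≗ (λ j → expand (adj G i j) (δ i j) (adj G u i) (adj G u j) (x j)) ⟩
  sum (λ j → (adj G i j ∧ x j) xor
             ((adj G u i ∧ (adj G u j ∧ x j)) xor (adj G u i ∧ ((adj G u j ∧ x j) ∧ δ i j))))
    ≡⟨ ∑-distrib-+ (λ j → adj G i j ∧ x j) _ ⟩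
  image G x i xor sum (λ j → (adj G u i ∧ (adj G u j ∧ x j)) xor
                             (adj G u i ∧ ((adj G u j ∧ x j) ∧ δ i j)))
    ≡⟨ cong (image G x i xor_) (∑-distrib-+ (λ j → adj G u i ∧ (adj G u j ∧ x j)) _) ⟩
  image G x i xor (sum (λ j → adj G u i ∧ (adj G u j ∧ x j)) xor
                   sum (λ j → adj G u i ∧ ((adj G u j ∧ x j) ∧ δ i j)))
    ≡⟨ cong (image G x i xor_) (cong₂ _xor_
         (sym (*-distribˡ-sum (adj G u i) (λ j → adj G u j ∧ x j)))
         (trans (sym (*-distribˡ-sum (adj G u i) (λ j → (adj G u j ∧ x j) ∧ δ i j)))
           (trans (cong (adj G u i ∧_) (sum-∧-δ (λ j → adj G u j ∧ x j) i))
             (absorb (adj G u i) (x i))))) ⟩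
  image G x i xor ((adj G u i ∧ image G x u) xor (adj G u i ∧ x i)) ∎
  where
  open ≡-Reasoning
  expand : ∀ a e p q b → (a xor (not e ∧ (p ∧ q))) ∧ b ≡
           (a ∧ b) xor ((p ∧ (q ∧ b)) xor (p ∧ ((q ∧ b) ∧ e)))
  expand = solve 5 (λ a e p q b → (a :+ ((con true :+ e) :* (p :* q))) :* b :=
    (a :* b) :+ ((p :* (q :* b)) :+ (p :* ((q :* b) :* e)))) refl
    where open xor-∧-Solver
  absorb : ∀ p b → p ∧ (p ∧ b) ≡ p ∧ b
  absorb false b = refl
  absorb true  b = refl

-- Local complementation is a shear: adding y u to x u, and x i to y i for every
-- neighbour i of u, carries L(G ⋆ u) into L(G).
shear₁ : Fin n → (Fin n → Bool) → (Fin n → Bool) → Fin n → Bool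
shear₁ u x y i = x i xor (δ u i ∧ y u)

shear₂ : (Fin n → Bool) → (Fin n → Bool) → (Fin n → Bool) → Fin n → Bool
shear₂ a x y i = y i xor (a i ∧ x i)

image-shear : (G : Graph n) (u : Fin n) (x y : Fin n → Bool) →
              image (G ⋆ u) x ≗ y → image G (shear₁ u x y) ≗ shear₂ (adj G u) x y
image-shear G u x y A⋆x≗y i = begin
  image G (shear₁ u x y) i
    ≡⟨ image-xor G x (λ j → δ u j ∧ y u) i ⟩
  image G x i xor image G (λ j → δ u j ∧ y u) i
    ≡⟨ cong (image G x i xor_) (trans (image-∧δ G u (y u) i)
         (cong₂ _∧_ (adj-sym G i u) y-u)) ⟩
  image G x i xor (adj G u i ∧ image G x u)
    ≡⟨ cancel (image G x i) (adj G u i) (image G x u) (x i) ⟩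
  (image G x i xor ((adj G u i ∧ image G x u) xor (adj G u i ∧ x i))) xor (adj G u i ∧ x i)
    ≡⟨ cong (_xor (adj G u i ∧ x i)) (trans (sym (image-⋆ G u x i)) (A⋆x≗y i)) ⟩
  shear₂ (adj G u) x y i ∎
  where
  open ≡-Reasoning
  -- The row of `u` is unchanged by local complementation at `u`, so `y` and `image G x` agree
  -- there.
  y-u : y u ≡ image G x u
  y-u = begin
    y u                 ≡⟨ A⋆x≗y u ⟨
    image (G ⋆ u) x u   ≡⟨ image-⋆ G u x u ⟩
    image G x u xor ((adj G u u ∧ image G x u) xor (adj G u u ∧ x u))
      ≡⟨ cong (λ a → image G x u xor ((a ∧ image G x u) xor (a ∧ x u))) (adj-irr G u) ⟩
    image G x u xor false ≡⟨ Bool.xor-identityʳ (image G x u) ⟩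
    image G x u ∎
  cancel : ∀ a p q b → a xor (p ∧ q) ≡ (a xor ((p ∧ q) xor (p ∧ b))) xor (p ∧ b)
  cancel = solve 4 (λ a p q b →
    a :+ (p :* q) := (a :+ ((p :* q) :+ (p :* b))) :+ (p :* b)) refl
    where open xor-∧-Solver

exchange : (X x y : Fin n → Bool) → Fin n → Bool
exchange X x y i = if X i then y i else x i

-- Exchanging the components on X carries L(H) into L(G).
infix 4 _↝[_]_
record _↝[_]_ (H : Graph n) (X : Fin n → Bool) (G : Graph n) : Set where
  constructor mk↝
  field
    image-exchange : ∀ x y → image H x ≗ y → image G (exchange X x y) ≗ exchange X y x

open _↝[_]_ public

↝-refl : {G : Graph n} → G ↝[ (λ _ → false) ] G
↝-refl .image-exchange x y eq = eq

-- For distinct `u` and `v` this is the indicator of the set of both. It serves as an exchange set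
-- and also as a vector, and the form as a sum suits `image-xor`.
pair : Fin n → Fin n → Fin n → Bool
pair u v i = δ u i xor δ v i

-- Two exchanges at one vertex cancel, so the sets compose by symmetric difference.
↝-trans : {F G H : Graph n} {X Y : Fin n → Bool} →
          F ↝[ X ] G → G ↝[ Y ] H → F ↝[ (λ i → Y i xor X i) ] H
↝-trans {H = H} {X} {Y} F↝G G↝H .image-exchange x y eq i = begin
  image H (exchange (λ j → Y j xor X j) x y) i
    ≡⟨ image-cong H (λ j → exchange-∘ (Y j) (X j) (x j) (y j)) i ⟩
  image H (exchange Y (exchange X x y) (exchange X y x)) i
    ≡⟨ G↝H .image-exchange _ _ (F↝G .image-exchange x y eq) i ⟩
  exchange Y (exchange X y x) (exchange X x y) i
    ≡⟨ exchange-∘ (Y i) (X i) (y i) (x i) ⟨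
  exchange (λ j → Y j xor X j) y x i ∎
  where
  open ≡-Reasoning
  exchange-∘ : ∀ b c x y → (if b xor c then y else x) ≡
    (if b then (if c then x else y) else (if c then y else x))
  exchange-∘ false c     x y = refl
  exchange-∘ true  false x y = refl
  exchange-∘ true  true  x y = refl

⋆-≢ : (G : Graph n) (u : Fin n) {x y : Fin n} → x ≢ y →
      adj (G ⋆ u) x y ≡ adj G x y xor (adj G u x ∧ adj G u y)
⋆-≢ G u x≢y rewrite δ-≢ x≢y = refl

⋆-row : (G : Graph n) (u y : Fin n) → adj (G ⋆ u) u y ≡ adj G u y
⋆-row G u y rewrite adj-irr G u | Bool.∧-zeroʳ (distinct u y) = Bool.xor-identityʳ (adj G u y)

-- The three shears of a pivot on uv; a, b and c are the rows u, v and u of G,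
-- of G ⋆ u and of (G ⋆ u) ⋆ v.
module _ {u v : Fin n} (u≢v : u ≢ v) (a b c : Fin n → Bool)
  (au : a u ≡ false) (av : a v ≡ true) (bu : b u ≡ true) (bv : b v ≡ false)
  (cu : c u ≡ false) (cv : c v ≡ true)
  (a+b+c : ∀ j → u ≢ j → v ≢ j → c j ≡ a j xor b j)
  (x y : Fin n → Bool) where

  private
    x₁ = shear₁ u x y
    y₁ = shear₂ c x y
    x₂ = shear₁ v x₁ y₁
    y₂ = shear₂ b x₁ y₁

  shears-fst : shear₁ u x₂ y₂ ≗ exchange (pair u v) x y
  shears-fst j with u ≟ j
  ... | yes refl rewrite δ-refl u | δ-≢ (u≢v ∘ sym) | cu | bu = lemma (x j) (y j)
    where
    lemma : ∀ p q → ((p xor q) xor false) xor ((q xor false) xor (p xor q)) ≡ q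
    lemma false false = refl
    lemma false true  = refl
    lemma true  false = refl
    lemma true  true  = refl
  ... | no u≢j with v ≟ j
  ...   | yes refl rewrite cv = lemma (x v) (y v)
    where
    lemma : ∀ p q → ((p xor false) xor (q xor p)) xor false ≡ q
    lemma false false = refl
    lemma false true  = refl
    lemma true  false = refl
    lemma true  true  = refl
  ...   | no v≢j = trans (Bool.xor-identityʳ _)
    (trans (Bool.xor-identityʳ _) (Bool.xor-identityʳ _))

  shears-snd : shear₂ a x₂ y₂ ≗ exchange (pair u v) y x
  shears-snd j with u ≟ j
  ... | yes refl rewrite δ-≢ (u≢v ∘ sym) | cu | bu | au = lemma (x j) (y j)
    where
    lemma : ∀ p q → ((q xor false) xor (p xor q)) xor false ≡ p
    lemma false false = refl
    lemma false true  = refl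
    lemma true  false = refl
    lemma true  true  = refl
  ... | no u≢j with v ≟ j
  ...   | yes refl rewrite cv | bv | av = lemma (x v) (y v)
    where
    lemma : ∀ p q → ((q xor p) xor false) xor ((p xor false) xor (q xor p)) ≡ p
    lemma false false = refl
    lemma false true  = refl
    lemma true  false = refl
    lemma true  true  = refl
  ...   | no v≢j rewrite a+b+c j u≢j v≢j = lemma (x j) (y j) (a j) (b j)
    where
    lemma : ∀ p q s r →
      ((q xor ((s xor r) ∧ p)) xor (r ∧ (p xor false))) xor
        (s ∧ ((p xor false) xor false)) ≡ q
    lemma = solve 4 (λ p q s r →
      ((q :+ ((s :+ r) :* p)) :+ (r :* (p :+ con false))) :+
        (s :* ((p :+ con false) :+ con false)) := q) refl
      where open xor-∧-Solver

module _ (G : Graph n) (u v : Fin n) (uv : adj G u v ≡ true) where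

  edge⇒≢ : u ≢ v
  edge⇒≢ refl = contradiction (trans (sym uv) (adj-irr G u)) λ ()

  private
    b c : Fin n → Bool
    b = adj (G ⋆ u) v
    c = adj ((G ⋆ u) ⋆ v) u

    bu : b u ≡ true
    bu = trans (adj-sym (G ⋆ u) v u) (trans (⋆-row G u v) uv)

    b-≢ : ∀ {i} → v ≢ i → b i ≡ adj G v i xor adj G u i
    b-≢ {i} v≢i = trans (⋆-≢ G u v≢i)
      (cong (λ p → adj G v i xor (p ∧ adj G u i)) uv)

    c-≢ : ∀ {i} → u ≢ i → c i ≡ adj G u i xor b i
    c-≢ {i} u≢i = trans (⋆-≢ (G ⋆ u) v u≢i)
      (cong₂ (λ p q → p xor (q ∧ b i)) (⋆-row G u i) bu)

    c-far : ∀ {i} → u ≢ i → v ≢ i → c i ≡ adj G v i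
    c-far {i} u≢i v≢i = trans (c-≢ u≢i) (trans (cong (adj G u i xor_) (b-≢ v≢i))
      (lemma (adj G u i) (adj G v i)))
      where
      lemma : ∀ p q → p xor (q xor p) ≡ q
      lemma false q     = Bool.xor-identityʳ q
      lemma true  false = refl
      lemma true  true  = refl

    cv : c v ≡ true
    cv = trans (c-≢ edge⇒≢) (cong₂ _xor_ uv (adj-irr (G ⋆ u) v))

  -- If p and q are the rows of `u` and `v` in `G`, the three local complementations add the
  -- products of p, of p + q and of q; over GF(2) only the mixed terms remain.
  pivot-far : ∀ {x y} → u ≢ x → v ≢ x → u ≢ y → v ≢ y →
    adj (pivot G u v) x y ≡
    adj G x y xor ((adj G u x ∧ adj G v y) xor (adj G v x ∧ adj G u y))
  pivot-far {x} {y} u≢x v≢x u≢y v≢y = by-cases (x ≟ y)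
    where
    open ≡-Reasoning
    open xor-∧-Solver
    by-cases : Dec (x ≡ y) → adj (pivot G u v) x y ≡
      adj G x y xor ((adj G u x ∧ adj G v y) xor (adj G v x ∧ adj G u y))
    -- On the diagonal the two mixed terms coincide and cancel.
    by-cases (yes refl) = trans (adj-irr (pivot G u v) x) (sym (cong₂ _xor_ (adj-irr G x)
      (trans (cong ((adj G u x ∧ adj G v x) xor_) (Bool.∧-comm (adj G v x) (adj G u x)))
        (Bool.xor-same (adj G u x ∧ adj G v x)))))
    by-cases (no x≢y) = begin
      adj (pivot G u v) x y
        ≡⟨ ⋆-≢ ((G ⋆ u) ⋆ v) u x≢y ⟩
      adj ((G ⋆ u) ⋆ v) x y xor (c x ∧ c y)
        ≡⟨ cong₂ _xor_ (⋆-≢ (G ⋆ u) v x≢y) (cong₂ _∧_ (c-far u≢x v≢x) (c-far u≢y v≢y)) ⟩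
      (adj (G ⋆ u) x y xor (b x ∧ b y)) xor (adj G v x ∧ adj G v y)
        ≡⟨ cong (_xor (adj G v x ∧ adj G v y))
             (cong₂ _xor_ (⋆-≢ G u x≢y) (cong₂ _∧_ (b-≢ v≢x) (b-≢ v≢y))) ⟩
      ((adj G x y xor (adj G u x ∧ adj G u y)) xor
        ((adj G v x xor adj G u x) ∧ (adj G v y xor adj G u y))) xor (adj G v x ∧ adj G v y)
        ≡⟨ solve 5 (λ a p q r s →
             ((a :+ (p :* q)) :+ ((r :+ p) :* (s :+ q))) :+ (r :* s) :=
             a :+ ((p :* s) :+ (r :* q))) refl
             (adj G x y) (adj G u x) (adj G u y) (adj G v x) (adj G v y) ⟩
      adj G x y xor ((adj G u x ∧ adj G v y) xor (adj G v x ∧ adj G u y)) ∎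

  -- The first step turns the row of `v` into the sum of both rows, the second keeps it, and the
  -- third, `v` being a neighbour of `u`, removes the old row of `v`.
  pivot-near : ∀ {y} → u ≢ y → v ≢ y → adj (pivot G u v) v y ≡ adj G u y
  pivot-near {y} u≢y v≢y = begin
    adj (pivot G u v) v y
      ≡⟨ ⋆-≢ ((G ⋆ u) ⋆ v) u v≢y ⟩
    adj ((G ⋆ u) ⋆ v) v y xor (c v ∧ c y)
      ≡⟨ cong₂ _xor_ (trans (⋆-row (G ⋆ u) v y) (b-≢ v≢y)) (cong₂ _∧_ cv (c-far u≢y v≢y)) ⟩
    (adj G v y xor adj G u y) xor adj G v y
      ≡⟨ lemma (adj G v y) (adj G u y) ⟩
    adj G u y ∎
    where
    open ≡-Reasoning
    lemma : ∀ p q → (p xor q) xor p ≡ q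
    lemma false q     = Bool.xor-identityʳ q
    lemma true  false = refl
    lemma true  true  = refl

  pivot-edge : adj (pivot G u v) u v ≡ true
  pivot-edge = trans (⋆-row ((G ⋆ u) ⋆ v) u v) cv

  -- The shears of the three local complementations compose to the exchange at `u` and `v`.
  pivot-↝ : pivot G u v ↝[ pair u v ] G
  pivot-↝ .image-exchange x y eq i = begin
    image G (exchange (pair u v) x y) i
      ≡⟨ image-cong G (λ j → sym (shears-fst edge⇒≢ (adj G u) b c (adj-irr G u) uv bu
           (adj-irr (G ⋆ u) v) (adj-irr ((G ⋆ u) ⋆ v) u) cv a+b+c x y j)) i ⟩
    image G (shear₁ u x₂ y₂) i
      ≡⟨ image-shear G u x₂ y₂ (image-shear (G ⋆ u) v _ _
           (image-shear ((G ⋆ u) ⋆ v) u x y eq)) i ⟩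
    shear₂ (adj G u) x₂ y₂ i
      ≡⟨ shears-snd edge⇒≢ (adj G u) b c (adj-irr G u) uv bu
           (adj-irr (G ⋆ u) v) (adj-irr ((G ⋆ u) ⋆ v) u) cv a+b+c x y i ⟩
    exchange (pair u v) y x i ∎
    where
    open ≡-Reasoning
    x₂ = shear₁ v (shear₁ u x y) (shear₂ c x y)
    y₂ = shear₂ b (shear₁ u x y) (shear₂ c x y)
    a+b+c : ∀ j → u ≢ j → v ≢ j → c j ≡ adj G u j xor b j
    a+b+c j u≢j _ = c-≢ u≢j

module _ {G H : Graph n} {X : Fin n → Bool} (H↝G : H ↝[ X ] G) where

  -- The exchange turns the pair of `x` and its image under `H` into a pair of `G` with zero first
  -- component. Its second component must then vanish too, and on `X` it is `x`.
  ↝-kernel : (x : Fin n → Bool) → (∀ i → X i ≡ true → image H x i ≡ false) →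
    (∀ i → X i ≡ false → x i ≡ false) → ∀ i → X i ≡ true → x i ≡ false
  ↝-kernel x Hx≡0 x≡0 i Xi = begin
    x i
      ≡⟨ cong (λ b → if b then x i else image H x i) Xi ⟨
    exchange X (image H x) x i
      ≡⟨ H↝G .image-exchange x (image H x) (λ _ → refl) i ⟨
    image G (exchange X x (image H x)) i
      ≡⟨ image-false G vanishes i ⟩
    false ∎
    where
    open ≡-Reasoning
    vanishes : ∀ j → exchange X x (image H x) j ≡ false
    vanishes j with X j in Xj
    ... | true  = Hx≡0 j Xj
    ... | false = x≡0 j Xj

  -- Otherwise the unit vector at `v` would contradict `↝-kernel`.
  ↝-neighbour : ∀ {v} → X v ≡ true → ∃ λ w → X w ≡ true × adj H v w ≡ true
  ↝-neighbour {v} Xv with any? (λ w → (X w Bool.≟ true) ×-dec (adj H v w Bool.≟ true))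
  ... | yes found = found
  ... | no  none  = contradiction
    (trans (sym (δ-refl v)) (↝-kernel (δ v) isolated outside v Xv)) λ ()
    where
    isolated : ∀ i → X i ≡ true → image H (δ v) i ≡ false
    isolated i Xi = trans (image-δ H v i) (trans (adj-sym H i v)
      (Bool.¬-not (λ vi → none (i , Xi , vi))))
    outside : ∀ i → X i ≡ false → δ v i ≡ false
    outside i Xi = δ-≢ {u = v} {i} λ { refl → contradiction (trans (sym Xv) Xi) λ () }

  ↝-false : (∀ i → X i ≡ false) → ∀ x y → adj G x y ≡ adj H x y
  ↝-false X≡0 x y = begin
    adj G x y
      ≡⟨ image-δ G y x ⟨
    image G (δ y) x
      ≡⟨ image-cong G (λ j → cong (λ b → if b then image H (δ y) j else δ y j) (X≡0 j)) x ⟨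
    image G (exchange X (δ y) (image H (δ y))) x
      ≡⟨ H↝G .image-exchange (δ y) (image H (δ y)) (λ _ → refl) x ⟩
    exchange X (image H (δ y)) (δ y) x
      ≡⟨ cong (λ b → if b then δ y x else image H (δ y) x) (X≡0 x) ⟩
    image H (δ y) x
      ≡⟨ image-δ H y x ⟩
    adj H x y ∎
    where open ≡-Reasoning

-- Pivots, induced subgraphs and pivot-minors

infix 4 _≋_
-- Propositional equality of graphs would need function extensionality and would also compare the
-- proof fields.
record _≋_ (G H : Graph n) : Set where
  constructor mk≋
  field
    adj-≡ : ∀ x y → adj G x y ≡ adj H x y

open _≋_ public

≋-trans : {F G H : Graph n} → F ≋ G → G ≋ H → F ≋ H
≋-trans F≋G G≋H .adj-≡ x y = trans (adj-≡ F≋G x y) (adj-≡ G≋H x y)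

⋆-cong : {G H : Graph n} (u : Fin n) → G ≋ H → G ⋆ u ≋ H ⋆ u
⋆-cong u G≋H .adj-≡ x y = cong₂ _xor_ (adj-≡ G≋H x y)
  (cong (distinct x y ∧_) (cong₂ _∧_ (adj-≡ G≋H u x) (adj-≡ G≋H u y)))

pivot-cong : {G H : Graph n} (u v : Fin n) → G ≋ H → pivot G u v ≋ pivot H u v
pivot-cong u v G≋H = ⋆-cong u (⋆-cong v (⋆-cong u G≋H))

⋆-involutive : (G : Graph n) (u : Fin n) → (G ⋆ u) ⋆ u ≋ G
⋆-involutive G u .adj-≡ x y = begin
  adj (G ⋆ u) x y xor (distinct x y ∧ (adj (G ⋆ u) u x ∧ adj (G ⋆ u) u y))
    ≡⟨ cong (adj (G ⋆ u) x y xor_)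
         (cong (distinct x y ∧_) (cong₂ _∧_ (⋆-row G u x) (⋆-row G u y))) ⟩
  (adj G x y xor d) xor d
    ≡⟨ Bool.xor-assoc (adj G x y) d d ⟩
  adj G x y xor (d xor d)
    ≡⟨ cong (adj G x y xor_) (Bool.xor-same d) ⟩
  adj G x y xor false
    ≡⟨ Bool.xor-identityʳ (adj G x y) ⟩
  adj G x y ∎
  where
  open ≡-Reasoning
  d = distinct x y ∧ (adj G u x ∧ adj G u y)

-- The sequence u, v, u is a palindrome, so the six local complementations cancel from the middle
-- outwards.
pivot-involutive : (G : Graph n) (u v : Fin n) → pivot (pivot G u v) u v ≋ G
pivot-involutive G u v =
  ≋-trans (⋆-cong u (⋆-cong v (⋆-involutive ((G ⋆ u) ⋆ v) u)))
    (≋-trans (⋆-cong u (⋆-involutive (G ⋆ u) v)) (⋆-involutive G u))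

induced-⋆ : (G : Graph n) (f : Fin m ↣ Fin n) (a : Fin m) →
            induced G f ⋆ a ≋ induced (G ⋆ Injection.to f a) f
induced-⋆ G f a .adj-≡ x y =
  cong (λ d → adj G (to x) (to y) xor (not d ∧ (adj G (to a) (to x) ∧ adj G (to a) (to y))))
    (δ-to (x ≟ y))
  where
  open Injection f using (to; injective)
  δ-to : Dec (x ≡ y) → δ x y ≡ δ (to x) (to y)
  δ-to (yes refl) = trans (δ-refl x) (sym (δ-refl (to x)))
  δ-to (no  x≢y)  = trans (δ-≢ x≢y) (sym (δ-≢ (x≢y ∘ injective)))

induced-pivot : (G : Graph n) (f : Fin m ↣ Fin n) (a b : Fin m) →
  pivot (induced G f) a b ≋ induced (pivot G (Injection.to f a) (Injection.to f b)) f
induced-pivot G f a b =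
  ≋-trans (⋆-cong a (⋆-cong b (induced-⋆ G f a)))
    (≋-trans (⋆-cong a (induced-⋆ (G ⋆ to a) f b)) (induced-⋆ ((G ⋆ to a) ⋆ to b) f a))
  where open Injection f using (to)

PivotMinor-trans : {G : Graph n} {H : Graph m} {K : Graph k} →
                   PivotMinor G H → PivotMinor H K → PivotMinor G K
PivotMinor-trans p self                = p
PivotMinor-trans p (delete q v)        = delete (PivotMinor-trans p q) v
PivotMinor-trans p (pivotEdge q u v e) = pivotEdge (PivotMinor-trans p q) u v e

module _ (v : Fin (suc n)) (g : Fin m ↣ Fin (suc n)) (v∉g : ∀ a → v ≢ Injection.to g a) where

  avoid : Fin m ↣ Fin n
  avoid = mk↣ {to = λ a → punchOut (v∉g a)}
    (λ eq → Injection.injective g (punchOut-injective (v∉g _) (v∉g _) eq))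

  punchIn-avoid : ∀ a → punchIn v (Injection.to avoid a) ≡ Injection.to g a
  punchIn-avoid a = punchIn-punchOut (v∉g a)

-- Vertices missed by `g` are deleted one at a time; once `g` is onto, it is an isomorphism.
embedding⇒pivotMinor : (G : Graph n) (H : Graph m) (g : Fin m ↣ Fin n) →
  induced G g ≋ H → HasPivotMinorIsoTo G H
embedding⇒pivotMinor {n = n} G H g g-emb with all? (λ i → any? (λ a → Injection.to g a ≟ i))
... | yes onto = n , G , self , record
  { vertices = mk↔ₛ′ inv to (λ a → injective (proj₂ (onto (to a)))) (λ i → proj₂ (onto i))
  ; preserve = λ x y → trans (sym (adj-≡ g-emb (inv x) (inv y)))
                             (cong₂ (adj G) (proj₂ (onto x)) (proj₂ (onto y)))
  }
  where
  open Injection g using (to; injective)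
  inv : ∀ i → Fin _
  inv i = proj₁ (onto i)
embedding⇒pivotMinor {n = zero}  G H g g-emb | no ¬onto = contradiction (λ ()) ¬onto
embedding⇒pivotMinor {n = suc n} G H g g-emb | no ¬onto
  with ¬∀⟶∃¬ (suc n) _ (λ i → any? (λ a → Injection.to g a ≟ i)) ¬onto
... | v , v∉g
  with embedding⇒pivotMinor (deleteVertex G v) H (avoid v g v≢) (mk≋ λ a b →
    trans (cong₂ (adj G) (punchIn-avoid v g v≢ a) (punchIn-avoid v g v≢ b)) (adj-≡ g-emb a b))
  where
  v≢ : ∀ a → v ≢ Injection.to g a
  v≢ a eq = v∉g (a , sym eq)
... | j , K , G∖v≥K , K≅H = j , K , PivotMinor-trans (delete self v) G∖v≥K , K≅H

-- All pivots are made on the full vertex set, and a deletion merely shrinks the embedding `f`; thus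
-- `G′` keeps every vertex of `G`.
pivotMinor⇒↝ : {G : Graph n} {H : Graph m} → PivotMinor G H →
  ∃ λ G′ → ∃ λ X → ∃ λ f → G′ ↝[ X ] G × induced G′ f ≋ H
pivotMinor⇒↝ {G = G} self = G , _ , mk↣ {to = λ x → x} (λ eq → eq) , ↝-refl , mk≋ λ _ _ → refl
pivotMinor⇒↝ (delete p v) with pivotMinor⇒↝ p
... | G′ , X , f , G′↝G , f-emb =
  G′ , X , mk↣ {to = to ∘ punchIn v} (punchIn-injective v _ _ ∘ injective) , G′↝G ,
  mk≋ λ x y → adj-≡ f-emb (punchIn v x) (punchIn v y)
  where open Injection f using (to; injective)
pivotMinor⇒↝ (pivotEdge p u v uv) with pivotMinor⇒↝ p
... | G′ , X , f , G′↝G , f-emb =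
  pivot G′ (to u) (to v) , _ , f ,
  ↝-trans (pivot-↝ G′ (to u) (to v) (trans (adj-≡ f-emb u v) uv)) G′↝G ,
  ≋-trans (mk≋ λ x y → sym (adj-≡ (induced-pivot G′ f u v) x y)) (pivot-cong u v f-emb)
  where open Injection f using (to)

xor-pair-⊆ : (X : Fin n → Bool) {v w : Fin n} → v ≢ w → X v ≡ true → X w ≡ true →
  ∀ i → X i xor pair v w i ≡ true → X i ≡ true × v ≢ i
xor-pair-⊆ X {v} {w} v≢w Xv Xw i eq with v ≟ i
... | yes refl rewrite Xv | δ-≢ (v≢w ∘ sym) = contradiction eq λ ()
... | no v≢i with w ≟ i
...   | yes refl = Xw , v≢i
...   | no  _    = trans (sym (Bool.xor-identityʳ (X i))) eq , v≢i

-- The bound k on the vertices of X drives the recursion: pivoting on the last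
-- vertex of X and a neighbour of it in X removes both from X.
↝⇒pivotMinor : {G : Graph n} (f : Fin m ↣ Fin n) (k : ℕ) (H : Graph n) (X : Fin n → Bool) →
  H ↝[ X ] G → (∀ i → X i ≡ true → toℕ i < k) → (∀ i → X i ≡ true → ∃ λ a → Injection.to f a ≡ i) →
  ∃ λ K → PivotMinor (induced G f) K × K ≋ induced H f
↝⇒pivotMinor {G = G} f zero H X H↝G X<k X⊆f = induced G f , self ,
  mk≋ λ x y → ↝-false H↝G (λ i → Bool.¬-not (λ Xi → contradiction (X<k i Xi) λ ())) _ _
↝⇒pivotMinor {G = G} f (suc k) H X H↝G X<k X⊆f
  with any? (λ i → (toℕ i ℕ.≟ k) ×-dec (X i Bool.≟ true))
... | no  none = ↝⇒pivotMinor f k H X H↝G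
  (λ i Xi → ℕ.≤∧≢⇒< (s≤s⁻¹ (X<k i Xi)) (λ eq → none (i , eq , Xi))) X⊆f
... | yes (v , v≡k , Xv) with ↝-neighbour H↝G Xv
...   | w , Xw , vw with X⊆f v Xv | X⊆f w Xw
...   | a , refl | b , refl
  with ↝⇒pivotMinor {G = G} f k (pivot H v w) (λ i → X i xor pair v w i)
    (↝-trans (pivot-↝ H v w vw) H↝G)
    (λ i Xi → let Xi′ , v≢i = xor-pair-⊆ X (edge⇒≢ H v w vw) Xv Xw i Xi in
      ℕ.≤∧≢⇒< (s≤s⁻¹ (X<k i Xi′)) (λ eq → v≢i (toℕ-injective (trans v≡k (sym eq)))))
    (λ i Xi → X⊆f i (proj₁ (xor-pair-⊆ X (edge⇒≢ H v w vw) Xv Xw i Xi)))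
... | K , G≥K , K≋H =
  pivot K a b , pivotEdge G≥K a b (trans (adj-≡ K≋H a b) (pivot-edge H v w vw)) ,
  ≋-trans (pivot-cong a b K≋H) (≋-trans (induced-pivot (pivot H v w) f a b)
    (mk≋ λ x y → adj-≡ (pivot-involutive H v w) _ _))

-- Induced stars and minimality

AllPairs-lookup : ∀ {A : Set} {R : A → A → Set} → Symmetric R → {xs : List A} → AllPairs R xs →
  ∀ {i j} → i ≢ j → R (lookup xs i) (lookup xs j)
AllPairs-lookup R-sym (_  ∷ _)  {zero}  {zero}  i≢j = contradiction refl i≢j
AllPairs-lookup R-sym (px ∷ _)  {zero}  {suc j} i≢j = All.lookup px (∈-lookup j)
AllPairs-lookup R-sym (px ∷ _)  {suc i} {zero}  i≢j = R-sym (All.lookup px (∈-lookup i))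
AllPairs-lookup R-sym (_ ∷ pxs) {suc i} {suc j} i≢j = AllPairs-lookup R-sym pxs (i≢j ∘ cong suc)

Apart : Graph n → Fin n → Fin n → Set
Apart G x y = x ≢ y × adj G x y ≡ false

Apart-sym : (G : Graph n) → Symmetric (Apart G)
Apart-sym G (x≢y , xy) = x≢y ∘ sym , trans (adj-sym G _ _) xy

-- A star of H that avoids v and has at least t leaves.
record ListStar (H : Graph n) (t : ℕ) (v : Fin n) : Set where
  field
    centre : Fin n
    leaves : List (Fin n)
    size   : t ≤ length leaves
    apart  : AllPairs (Apart H) leaves
    joined : All (λ b → adj H centre b ≡ true) leaves
    centre≢ : v ≢ centre
    leaves≢ : All (v ≢_) leaves

module _ {H : Graph n} {v : Fin n} (S : ListStar H t v) where
  open ListStar S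

  private
    leaf : Fin t → Fin n
    leaf i = lookup leaves (inject≤ i size)

    centre-leaf : ∀ i → adj H centre (leaf i) ≡ true
    centre-leaf i = All.lookup joined (∈-lookup (inject≤ i size))

    leaf-apart : ∀ {i j} → i ≢ j → Apart H (leaf i) (leaf j)
    leaf-apart i≢j = AllPairs-lookup (Apart-sym H) apart (i≢j ∘ inject≤-injective size size _ _)

    at : Fin (suc t) → Fin n
    at zero    = centre
    at (suc i) = leaf i

    at-injective : ∀ {a b} → at a ≡ at b → a ≡ b
    at-injective {zero}  {zero}  eq = refl
    at-injective {zero}  {suc j} eq = contradiction eq (edge⇒≢ H _ _ (centre-leaf j))
    at-injective {suc i} {zero}  eq = contradiction (sym eq) (edge⇒≢ H _ _ (centre-leaf i))
    at-injective {suc i} {suc j} eq with i ≟ j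
    ... | yes refl = refl
    ... | no  i≢j  = contradiction eq (proj₁ (leaf-apart i≢j))

  starEmbedding : Fin (suc t) ↣ Fin n
  starEmbedding = mk↣ at-injective

  starEmbedding-≋ : induced H starEmbedding ≋ star t
  starEmbedding-≋ .adj-≡ zero    zero    = adj-irr H centre
  starEmbedding-≋ .adj-≡ zero    (suc j) = centre-leaf j
  starEmbedding-≋ .adj-≡ (suc i) zero    = trans (adj-sym H (leaf i) centre) (centre-leaf i)
  starEmbedding-≋ .adj-≡ (suc i) (suc j) with i ≟ j
  ... | yes refl = adj-irr H (leaf i)
  ... | no  i≢j  = proj₂ (leaf-apart i≢j)

  starEmbedding-≢ : ∀ a → v ≢ Injection.to starEmbedding a
  starEmbedding-≢ zero    = centre≢
  starEmbedding-≢ (suc i) = All.lookup leaves≢ (∈-lookup (inject≤ i size))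

punchIn-↣ : Fin (suc n) → Fin n ↣ Fin (suc n)
punchIn-↣ v = mk↣ {to = punchIn v} (punchIn-injective v _ _)

-- As `v` is not exchanged, `H` without `v` is a pivot-minor of `G` without `v`. A copy of `F` in it
-- would make a proper induced subgraph of `G` have `F` as a pivot-minor.
minimal⇒no-embedding : {G : Graph (suc n)} {F : Graph m} → InducedSubgraphMinimal G F →
  {H : Graph (suc n)} {X : Fin (suc n) → Bool} {v : Fin (suc n)} → H ↝[ X ] G → X v ≡ false →
  (g : Fin m ↣ Fin (suc n)) → (∀ a → v ≢ Injection.to g a) → ¬ induced H g ≋ F
minimal⇒no-embedding {G = G} {F} (_ , minimal) {H} {X} {v} H↝G Xv g v∉g g-emb
  with ↝⇒pivotMinor {G = G} (punchIn-↣ v) _ H X H↝G (λ i _ → toℕ<n i)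
    (λ i Xi → punchOut {i = v} (v≢ Xi) , punchIn-punchOut (v≢ Xi))
  where
  v≢ : ∀ {i} → X i ≡ true → v ≢ i
  v≢ Xi refl = contradiction (trans (sym Xi) Xv) λ ()
... | K , G∖v≥K , K≋H∖v
  with embedding⇒pivotMinor K F (avoid v g v∉g) (mk≋ λ a b → trans (adj-≡ K≋H∖v _ _)
    (trans (cong₂ (adj H) (punchIn-avoid v g v∉g a) (punchIn-avoid v g v∉g b)) (adj-≡ g-emb a b)))
... | j , K′ , K≥K′ , K′≅F =
  minimal (ℕ.n<1+n _) (punchIn-↣ v) (j , K′ , PivotMinor-trans G∖v≥K K≥K′ , K′≅F)

-- Counting

length-filter-¬? : {P : A → Set} (P? : Decidable P) (xs : List A) →
  length (filter P? xs) + length (filter (¬? ∘ P?) xs) ≡ length xs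
length-filter-¬? P? []       = refl
length-filter-¬? P? (x ∷ xs) with P? x
... | yes _ = cong suc (length-filter-¬? P? xs)
... | no  _ = trans (ℕ.+-suc _ _) (cong suc (length-filter-¬? P? xs))

AllPairs-map : {P : A → Set} {R : A → A → Set} {S : B → B → Set} {f : A → B} →
  (∀ {x y} → P x → P y → R x y → S (f x) (f y)) →
  ∀ {xs} → All P xs → AllPairs R xs → AllPairs S (map f xs)
AllPairs-map g []       []         = []
AllPairs-map g (p ∷ ps) (rs ∷ rss) =
  All.map⁺ (All.zipWith (λ (q , r) → g p q r) (ps , rs)) ∷ AllPairs-map g ps rss

fibres-bound : (φ : A → ℕ) (k : ℕ) →
  (∀ c {ys} → Unique ys → All (λ y → φ y ≡ c) ys → length ys ≤ k) →
  ∀ m {xs} → Unique xs → All (λ x → φ x < m) xs → length xs ≤ m * k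
fibres-bound φ k fibre≤k zero    []      []       = z≤n
fibres-bound φ k fibre≤k zero    (_ ∷ _) (() ∷ _)
fibres-bound φ k fibre≤k (suc m) {xs} xs! φ<1+m = begin
  length xs
    ≡⟨ length-filter-¬? φ≟m xs ⟨
  length (filter φ≟m xs) + length (filter (¬? ∘ φ≟m) xs)
    ≤⟨ ℕ.+-mono-≤
         (fibre≤k m (Unique.filter⁺ φ≟m xs!) (All.all-filter φ≟m xs))
         (fibres-bound φ k fibre≤k m (Unique.filter⁺ (¬? ∘ φ≟m) xs!)
           (All.zipWith (λ (φ≢m , φ<) → ℕ.≤∧≢⇒< (s≤s⁻¹ φ<) φ≢m)
             (All.all-filter (¬? ∘ φ≟m) xs , All.filter⁺ (¬? ∘ φ≟m) φ<1+m))) ⟩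
  k + m * k ∎
  where
  open ℕ.≤-Reasoning
  φ≟m : ∀ x → Dec (φ x ≡ m)
  φ≟m x = φ x ℕ.≟ m

-- The value `j` is never taken and is removed by `punchOut`, hence the factor `m ∸ 1`.
fibres-bound-Fin : (φ : Fin n → Fin m) (k : ℕ) (j : Fin m) → (∀ x → j ≢ φ x) →
  (∀ c {ys} → Unique ys → All (λ y → φ y ≡ c) ys → length ys ≤ k) →
  n ≤ (m ∸ 1) * k
fibres-bound-Fin {n = n} {m = suc m} φ k j j≢φ fibre≤k = subst (_≤ m * k)
  (length-tabulate {n = n} (λ x → x))
  (fibres-bound ψ k fibre m (Unique.allFin⁺ n) (All.universal (λ x → toℕ<n _) (allFin n)))
  where
  ψ : Fin n → ℕ
  ψ x = toℕ (punchOut (j≢φ x))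
  fibre : ∀ c {ys} → Unique ys → All (λ y → ψ y ≡ c) ys → length ys ≤ k
  fibre c {[]}     _   _          = z≤n
  -- The head supplies the value of `φ` common to the list, since `punchOut` is injective.
  fibre c {y ∷ ys} ys! (eq ∷ eqs) = fibre≤k (φ y) ys! (refl ∷ All.map (λ eq′ →
    punchOut-injective (j≢φ _) (j≢φ y) (toℕ-injective (trans eq′ (sym eq)))) eqs)

-- Vertices outside an induced star

opposite : Fin (suc (suc t)) → Fin (suc (suc t))
opposite zero    = suc zero
opposite (suc _) = zero

opposite-adj : (a : Fin (suc (suc t))) → adj (star (suc t)) a (opposite a) ≡ true
opposite-adj zero    = refl
opposite-adj (suc _) = refl

δ-true : (u i : Fin n) → δ u i ≡ true → u ≡ i
δ-true u i eq with u ≟ i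
... | yes u≡i = u≡i

xor-absorb : ∀ {b c d} → c ≡ false → d ≡ false → b xor (c xor d) ≡ b
xor-absorb {b} refl refl = Bool.xor-identityʳ b

∧-falseˡ : ∀ {b} c → b ≡ false → b ∧ c ≡ false
∧-falseˡ c refl = refl

∧-falseʳ : ∀ b {c} → c ≡ false → b ∧ c ≡ false
∧-falseʳ b refl = Bool.∧-zeroʳ b

adj-≢ : (H : Graph n) {x y z : Fin n} → adj H x y ≡ true → adj H x z ≡ false → y ≢ z
adj-≢ H xy xz refl = contradiction (trans (sym xy) xz) λ ()

-- Here the star is K_{1,t+1}, so every bound is shifted by one against the outline.
module _ {t : ℕ} {G : Graph (suc n)} (minimal : InducedSubgraphMinimal G (star (suc t)))
  {H : Graph (suc n)} {X : Fin (suc n) → Bool} (H↝G : H ↝[ X ] G)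
  (f : Fin (suc (suc t)) ↣ Fin (suc n)) (f-star : induced H f ≋ star (suc t)) where

  open Injection f using (injective) renaming (to to s)

  Outside : Fin (suc n) → Set
  Outside v = ∀ a → v ≢ s a

  SameTrace : Fin (suc n) → Fin (suc n) → Set
  SameTrace v w = ∀ a → adj H v (s a) ≡ adj H w (s a)

  outside⇒X : ∀ {v} → Outside v → X v ≡ true
  outside⇒X v∉S = Bool.¬-not λ Xv → minimal⇒no-embedding minimal H↝G Xv f v∉S f-star

  module _ {v w} (v∉S : Outside v) (vw : adj H v w ≡ true) where

    pivot-no-embedding : (g : Fin (suc (suc t)) ↣ Fin (suc n)) → (∀ a → v ≢ Injection.to g a) →
      ¬ induced (pivot H v w) g ≋ star (suc t)
    pivot-no-embedding = minimal⇒no-embedding minimal (↝-trans (pivot-↝ H v w vw) H↝G)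
      (cong₂ _xor_ (outside⇒X v∉S) (cong₂ _xor_ (δ-refl v) (δ-≢ (edge⇒≢ H v w vw ∘ sym))))

    pivot-no-star : ¬ ListStar (pivot H v w) (suc t) v
    pivot-no-star S = pivot-no-embedding (starEmbedding S) (starEmbedding-≢ S) (starEmbedding-≋ S)

    -- The expression is the change that the pivot makes on pairs in the star. Were it zero, the
    -- star would survive the pivot and still avoid `v`.
    pivot-changes-star : Outside w → ¬ (∀ a b →
      (adj H v (s a) ∧ adj H w (s b)) xor (adj H w (s a) ∧ adj H v (s b)) ≡ false)
    pivot-changes-star w∉S unchanged = pivot-no-embedding f v∉S (≋-trans (mk≋ λ a b →
      trans (pivot-far H v w vw (v∉S a) (w∉S a) (v∉S b) (w∉S b))
        (trans (cong (adj H (s a) (s b) xor_) (unchanged a b)) (Bool.xor-identityʳ _))) f-star)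

    -- After the pivot `w` has the former neighbours of `v`: it is joined to `s a` and to none of
    -- `bs`. Adjacencies between `s a` and `bs`, and within `bs`, are unchanged, so `s a` is the
    -- centre of a star with leaves `w ∷ bs`.
    few-nonNeighbours : Outside w → ∀ {a bs} → adj H v (s a) ≡ true →
      AllPairs (Apart H) bs → All (λ b → adj H (s a) b ≡ true) bs →
      All (λ b → adj H v b ≡ false) bs → All (λ b → adj H w b ≡ false) bs → length bs < t
    few-nonNeighbours w∉S {a} {bs} va apart joined v-bs w-bs = ℕ.≰⇒> λ t≤ → pivot-no-star record
      { centre  = s a
      ; leaves  = w ∷ bs
      ; size    = s≤s t≤
      ; apart   = All.map (λ (vb , wb) → adj-≢ H vw vb ,
                    trans (pivot-near H v w vw (v≢ wb) (adj-≢ H vw vb)) vb) far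
                  ∷ subst (AllPairs _) (map-id bs) (AllPairs-map
                    (λ (vb , wb) (vb′ , wb′) (b≢b′ , bb′) → b≢b′ ,
                    trans (pivot-far H v w vw (v≢ wb) (adj-≢ H vw vb) (v≢ wb′) (adj-≢ H vw vb′))
                      (trans (xor-absorb (∧-falseˡ _ vb) (∧-falseˡ _ wb)) bb′)) far apart)
      ; joined  = trans (adj-sym (pivot H v w) (s a) w)
                    (trans (pivot-near H v w vw (v∉S a) (w∉S a)) va)
                  ∷ All.zipWith (λ (ab , vb , wb) →
                      trans (pivot-far H v w vw (v∉S a) (w∉S a) (v≢ wb) (adj-≢ H vw vb))
                        (trans (xor-absorb (∧-falseʳ (adj H v (s a)) wb)
                          (∧-falseʳ (adj H w (s a)) vb)) ab)) (joined , far)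
      ; centre≢ = v∉S a
      ; leaves≢ = edge⇒≢ H v w vw ∷ All.map (λ (vb , wb) → v≢ wb) far
      }
      where
      far : All (λ b → adj H v b ≡ false × adj H w b ≡ false) bs
      far = All.zip (v-bs , w-bs)
      v≢ : ∀ {b} → adj H w b ≡ false → v ≢ b
      v≢ = adj-≢ H (trans (adj-sym H w v) vw)

    -- After the pivot `w` takes over the neighbours `bs` of `v`. They stay independent because each
    -- mixed term contains a nonadjacency to `w`.
    few-neighbours : ∀ {bs} → AllPairs (Apart H) (w ∷ bs) → All (λ b → adj H v b ≡ true) bs →
      length bs ≤ t
    few-neighbours {bs} (w-bs ∷ apart) v-bs = ℕ.≮⇒≥ λ t< → pivot-no-star record
      { centre  = w
      ; leaves  = bs
      ; size    = t<
      ; apart   = subst (AllPairs _) (map-id bs) (AllPairs-map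
                    (λ ((w≢b , wb) , vb) ((w≢b′ , wb′) , vb′) (b≢b′ , bb′) → b≢b′ ,
                      trans (pivot-far H v w vw (edge⇒≢ H v _ vb) w≢b (edge⇒≢ H v _ vb′) w≢b′)
                        (trans (xor-absorb (∧-falseʳ (adj H v _) wb′) (∧-falseˡ _ wb)) bb′))
                    near apart)
      ; joined  = All.map (λ ((w≢b , wb) , vb) →
                    trans (pivot-near H v w vw (edge⇒≢ H v _ vb) w≢b) vb) near
      ; centre≢ = edge⇒≢ H v w vw
      ; leaves≢ = All.map (edge⇒≢ H v _) v-bs
      }
      where
      near : All (λ b → Apart H w b × adj H v b ≡ true) bs
      near = All.zip (w-bs , v-bs)

  -- If `v` had no neighbour in the star, its neighbour `w` in `X` would lie outside the star, and
  -- pivoting on that edge would leave the star intact.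
  outside-trace : ∀ {v} → Outside v → ∃ λ a → adj H v (s a) ≡ true
  outside-trace {v} v∉S with any? (λ a → adj H v (s a) Bool.≟ true)
  ... | yes found = found
  ... | no  none with ↝-neighbour H↝G (outside⇒X v∉S)
  ...   | w , _ , vw = contradiction
    (λ a b → cong₂ _xor_ (∧-falseˡ _ (v-s a)) (∧-falseʳ (adj H w (s a)) (v-s b)))
    (pivot-changes-star v∉S vw (λ a → adj-≢ H vw (v-s a)))
    where
    v-s : ∀ a → adj H v (s a) ≡ false
    v-s a = Bool.¬-not λ va → none (a , va)

  -- For equal traces the two mixed terms of a pivot on `v` and `w` cancel on the star.
  sameTrace⇒nonadjacent : ∀ {v w} → Outside v → Outside w → SameTrace v w → adj H v w ≡ false
  sameTrace⇒nonadjacent {v} {w} v∉S w∉S same = Bool.¬-not λ vw → pivot-changes-star v∉S vw w∉S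
    λ a b → trans (cong₂ _xor_ (cong (adj H v (s a) ∧_) (sym (same b)))
                               (cong (_∧ adj H v (s b)) (sym (same a))))
                  (Bool.xor-same (adj H v (s a) ∧ adj H v (s b)))

  -- Otherwise the indicator vector z of {v , v′} would give a pair (z , y) of L(H)
  -- with y zero on X, which the exchange along X turns into (0 , y′) with y′ nonzero.
  distinguished : ∀ {v v′} → Outside v → Outside v′ → v ≢ v′ → SameTrace v v′ →
    ∃ λ w → Outside w × adj H v w ≢ adj H v′ w
  distinguished {v} {v′} v∉S v′∉S v≢v′ same
    with any? (λ w → ¬? (adj H v w Bool.≟ adj H v′ w))
  ... | yes (w , differ) = w , (λ { a refl → differ (same a) }) , differ
  ... | no  none = contradiction
    (trans (sym (cong₂ _xor_ (δ-refl v) (δ-≢ (v≢v′ ∘ sym))))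
      (↝-kernel H↝G (pair v v′) twins outside v (outside⇒X v∉S))) λ ()
    where
    twins : ∀ i → X i ≡ true → image H (pair v v′) i ≡ false
    twins i _ with adj H v i Bool.≟ adj H v′ i
    ... | no  differ = contradiction (i , differ) none
    ... | yes agree  = trans (image-xor H (δ v) (δ v′) i)
      (trans (cong₂ _xor_ (trans (image-δ H v i) (adj-sym H i v))
                          (trans (image-δ H v′ i) (trans (adj-sym H i v′) (sym agree))))
        (Bool.xor-same (adj H v i)))
    outside : ∀ i → X i ≡ false → pair v v′ i ≡ false
    outside i Xi = cong₂ _xor_ (δ-≢ {u = v} {i} λ { refl → X≢ v∉S Xi })
      (δ-≢ {u = v′} {i} λ { refl → X≢ v′∉S Xi })
      where
      X≢ : ∀ {j} → Outside j → X j ≢ false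
      X≢ j∉S Xj = contradiction (trans (sym (outside⇒X j∉S)) Xj) λ ()

  independent-bound : ∀ {v w a P} → Outside v → Outside w → adj H v w ≡ true → adj H v (s a) ≡ true →
    AllPairs (Apart H) P → All (λ b → adj H (s a) b ≡ true) P → All (λ b → adj H v b ≡ false) P →
    length P ≤ t + t
  independent-bound {v} {w} {a} {P} v∉S w∉S vw va apart joined v-P = s≤s⁻¹ (begin
    -- The added one absorbs the strict inequality for the nonneighbours of `w`.
    suc (length P)
      ≡⟨ cong suc (length-filter-¬? w? P) ⟨
    suc (length (filter w? P) + length (filter (¬? ∘ w?) P))
      ≡⟨ ℕ.+-suc (length (filter w? P)) _ ⟨
    length (filter w? P) + suc (length (filter (¬? ∘ w?) P))
      ≤⟨ ℕ.+-mono-≤ (neighbours (AllPairs.filter⁺ w? apart) (All.all-filter w? P))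
           (few-nonNeighbours v∉S vw w∉S va (AllPairs.filter⁺ (¬? ∘ w?) apart)
             (All.filter⁺ (¬? ∘ w?) joined) (All.filter⁺ (¬? ∘ w?) v-P)
             (All.map Bool.¬-not (All.all-filter (¬? ∘ w?) P))) ⟩
    suc (t + t) ∎)
    where
    open ℕ.≤-Reasoning
    w? : ∀ b → Dec (adj H w b ≡ true)
    w? b = adj H w b Bool.≟ true
    neighbours : ∀ {bs} → AllPairs (Apart H) bs → All (λ b → adj H w b ≡ true) bs →
      length bs ≤ suc t
    neighbours []       []          = z≤n
    -- The first neighbour of `w` is the other end of the pivot edge and is not a leaf, hence
    -- `suc t` instead of `t`.
    neighbours bs-apart (wb ∷ w-bs) = s≤s (few-neighbours w∉S wb bs-apart w-bs)

  -- Traces and the size of their fibres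

  place : ∀ y → (∃ λ b → y ≡ s b) ⊎ Outside y
  place y with any? (λ b → y ≟ s b)
  ... | yes found = inj₁ found
  ... | no  none  = inj₂ λ b eq → none (b , eq)

  code : Fin (suc n) → Fin (suc (suc t)) → Bool
  code y with place y
  ... | inj₁ (b , _) = δ b
  ... | inj₂ _       = λ a → adj H y (s a)

  -- ρ replaces a vertex of the star, which is coded by its own singleton, by a
  -- vertex that has the corresponding trace.
  ρ : Fin (suc n) → Fin (suc n)
  ρ y with place y
  ... | inj₁ (b , _) = s (opposite b)
  ... | inj₂ _       = y

  ρ-inside : ∀ {y b} → y ≡ s b → ρ y ≡ s (opposite b)
  ρ-inside {y} {b} eq with place y
  ... | inj₂ y∉S = contradiction eq (y∉S b)
  ... | inj₁ (b′ , eq′) = cong (s ∘ opposite) (injective (trans (sym eq′) eq))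

  ρ-outside : ∀ {y} → Outside y → ρ y ≡ y
  ρ-outside {y} y∉S with place y
  ... | inj₁ (b , eq) = contradiction eq (y∉S b)
  ... | inj₂ _        = refl

  code-nonzero : ∀ y → ∃ λ a → code y a ≡ true
  code-nonzero y with place y
  ... | inj₁ (b , _) = b , δ-refl b
  ... | inj₂ y∉S     = outside-trace y∉S

  module _ {κ : Fin (suc (suc t)) → Bool} where

    InFibre : Fin (suc n) → Set
    InFibre y = code y ≗ κ

    outside-code : ∀ y → Outside y → InFibre y → ∀ a → adj H y (s a) ≡ κ a
    outside-code y y∉S y∈κ with place y
    ... | inj₁ (b , eq) = contradiction eq (y∉S b)
    ... | inj₂ _        = y∈κ

    inside-code : ∀ {b} y → y ≡ s b → InFibre y → δ b ≗ κ
    inside-code {b} y eq y∈κ with place y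
    ... | inj₂ y∉S = contradiction eq (y∉S b)
    ... | inj₁ (b′ , eq′) with injective (trans (sym eq) eq′)
    ...   | refl = y∈κ

    inside-unique : ∀ {b b′} y y′ → y ≡ s b → y′ ≡ s b′ → InFibre y → InFibre y′ → y ≡ y′
    inside-unique {b} {b′} y y′ refl refl y∈κ y′∈κ = cong s (δ-true b b′
      (trans (inside-code _ refl y∈κ b′) (trans (sym (inside-code _ refl y′∈κ b′)) (δ-refl b′))))

    ρ-joined : ∀ {a} → κ a ≡ true → ∀ y → InFibre y → adj H (s a) (ρ y) ≡ true
    ρ-joined {a} κa y y∈κ with place y
    ... | inj₂ _ = trans (adj-sym H (s a) y) (trans (y∈κ a) κa)
    ... | inj₁ (b , _) with δ-true b a (trans (y∈κ a) κa)
    ...   | refl = trans (adj-≡ f-star b (opposite b)) (opposite-adj b)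

    -- If the fibre contains the star vertex `s b`, the trace of `v` is the singleton of `b`, which
    -- omits `opposite b`. Otherwise equal traces give nonadjacency.
    ρ-nonadjacent : ∀ {v} → Outside v → InFibre v → ∀ y → InFibre y → adj H v (ρ y) ≡ false
    ρ-nonadjacent {v} v∉S v∈κ y y∈κ with place y
    ... | inj₂ y∉S = sameTrace⇒nonadjacent v∉S y∉S
      λ a → trans (outside-code v v∉S v∈κ a) (sym (y∈κ a))
    ... | inj₁ (b , _) = trans (outside-code v v∉S v∈κ (opposite b)) (trans (sym (y∈κ (opposite b)))
      (δ-≢ (edge⇒≢ (star (suc t)) b (opposite b) (opposite-adj b))))

    -- This makes `ρ` injective on a fibre with independent image; a fibre contains at most one
    -- vertex of the star.
    ρ-apart : ∀ x y → InFibre x → InFibre y → x ≢ y → Apart H (ρ x) (ρ y)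
    ρ-apart x y x∈κ y∈κ x≢y = by-places (place x) (place y)
      where
      outside-inside : ∀ {x b} → ∀ y → Outside x → y ≡ s b → InFibre x → InFibre y →
        Apart H (ρ x) (ρ y)
      outside-inside y x∉S y≡s x∈κ y∈κ
        rewrite ρ-outside x∉S =
          (λ eq → x∉S _ (trans eq (ρ-inside y≡s))) , ρ-nonadjacent x∉S x∈κ y y∈κ
      by-places : (∃ λ b → x ≡ s b) ⊎ Outside x → (∃ λ b → y ≡ s b) ⊎ Outside y →
        Apart H (ρ x) (ρ y)
      by-places (inj₁ (_ , x≡s)) (inj₁ (_ , y≡s)) =
        contradiction (inside-unique x y x≡s y≡s x∈κ y∈κ) x≢y
      by-places (inj₁ (_ , x≡s)) (inj₂ y∉S) = Apart-sym H (outside-inside x y∉S x≡s y∈κ x∈κ)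
      by-places (inj₂ x∉S) (inj₁ (_ , y≡s)) = outside-inside y x∉S y≡s x∈κ y∈κ
      by-places (inj₂ x∉S) (inj₂ y∉S) rewrite ρ-outside x∉S =
        (λ eq → x≢y (trans eq (ρ-outside y∉S))) , ρ-nonadjacent x∉S x∈κ y y∈κ

    -- The image of the fibre under `ρ` is the independent set to be bounded; any neighbour `s a` of
    -- `v` in the star is joined to all of it.
    neighbourly-fibre-bound : ∀ {v w ys} → Outside v → InFibre v → Outside w → adj H v w ≡ true →
      Unique ys → All InFibre ys → length ys ≤ t + t
    neighbourly-fibre-bound {v} {w} {ys} v∉S v∈κ w∉S vw ys! ys∈κ with outside-trace v∉S
    ... | a , va = subst (_≤ t + t) (length-map ρ ys)
      (independent-bound v∉S w∉S vw va (AllPairs-map (λ {x} {y} → ρ-apart x y) ys∈κ ys!)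
        (All.map⁺ (All.map (λ {y} → ρ-joined (trans (sym (outside-code v v∉S v∈κ a)) va) y) ys∈κ))
        (All.map⁺ (All.map (λ {y} → ρ-nonadjacent v∉S v∈κ y) ys∈κ)))

    -- A vertex distinguishing `v` from `v′` is a neighbour of one of them, and either will do.
    outside-pair-bound : ∀ {v v′ ys} → Outside v → Outside v′ → v ≢ v′ → InFibre v → InFibre v′ →
      Unique ys → All InFibre ys → length ys ≤ t + t
    outside-pair-bound {v} {v′} v∉S v′∉S v≢v′ v∈κ v′∈κ ys! ys∈κ
      with distinguished v∉S v′∉S v≢v′
        (λ a → trans (outside-code v v∉S v∈κ a) (sym (outside-code v′ v′∉S v′∈κ a)))
    ... | w , w∉S , differ with adj H v w Bool.≟ true | adj H v′ w Bool.≟ true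
    ...   | yes vw | _       = neighbourly-fibre-bound v∉S v∈κ w∉S vw ys! ys∈κ
    ...   | no  _  | yes v′w = neighbourly-fibre-bound v′∉S v′∈κ w∉S v′w ys! ys∈κ
    ...   | no ¬vw | no ¬v′w = contradiction (trans (Bool.¬-not ¬vw) (sym (Bool.¬-not ¬v′w))) differ

    -- Up to two elements, `1 ≤ t` suffices. Among three, at most one belongs to the star, so two
    -- lie outside.
    fibre-bound : 1 ≤ t → ∀ {ys} → Unique ys → All InFibre ys → length ys ≤ t + t
    fibre-bound 1≤t {[]}          _ _ = z≤n
    fibre-bound 1≤t {_ ∷ []}      _ _ = ℕ.m≤n⇒m≤n+o t 1≤t
    fibre-bound 1≤t {_ ∷ _ ∷ []}  _ _ = ℕ.+-mono-≤ 1≤t 1≤t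
    fibre-bound 1≤t {x ∷ y ∷ z ∷ _} ys!@((x≢y ∷ x≢z ∷ _) ∷ (y≢z ∷ _) ∷ _) ys∈κ@(x∈κ ∷ y∈κ ∷ z∈κ ∷ _)
      = by-places (place x) (place y) (place z)
      where
      by-places : (∃ λ b → x ≡ s b) ⊎ Outside x → (∃ λ b → y ≡ s b) ⊎ Outside y →
        (∃ λ b → z ≡ s b) ⊎ Outside z → _
      by-places (inj₂ x∉S) (inj₂ y∉S) _ = outside-pair-bound x∉S y∉S x≢y x∈κ y∈κ ys! ys∈κ
      by-places (inj₂ x∉S) (inj₁ _) (inj₂ z∉S) = outside-pair-bound x∉S z∉S x≢z x∈κ z∈κ ys! ys∈κ
      by-places (inj₁ _) (inj₂ y∉S) (inj₂ z∉S) = outside-pair-bound y∉S z∉S y≢z y∈κ z∈κ ys! ys∈κ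
      by-places (inj₁ (_ , x≡s)) (inj₁ (_ , y≡s)) _ =
        contradiction (inside-unique x y x≡s y≡s x∈κ y∈κ) x≢y
      by-places (inj₁ (_ , x≡s)) (inj₂ _) (inj₁ (_ , z≡s)) =
        contradiction (inside-unique x z x≡s z≡s x∈κ z∈κ) x≢z
      by-places (inj₂ _) (inj₁ (_ , y≡s)) (inj₁ (_ , z≡s)) =
        contradiction (inside-unique y z y≡s z≡s y∈κ z∈κ) y≢z

  private
    bit : Bool → Fin 2
    bit = Inverse.from 2↔Bool
    unbit : Fin 2 → Bool
    unbit = Inverse.to 2↔Bool

    encode : Fin (suc n) → Fin (2 ^ suc (suc t))
    encode y = funToFin (bit ∘ code y)

    decode : Fin (2 ^ suc (suc t)) → Fin (suc (suc t)) → Bool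
    decode c a = unbit (finToFun c a)

    decode-encode : ∀ y → code y ≗ decode (encode y)
    decode-encode y a = sym (trans (cong unbit (finToFun-funToFin (bit ∘ code y) a))
      (Inverse.inverseˡ 2↔Bool refl))

  -- Codes are subsets of the `suc (suc t)` star vertices, and the empty one does not occur.
  vertex-bound : 1 ≤ t → suc n ≤ (2 ^ suc (suc t) ∸ 1) * (t + t)
  vertex-bound 1≤t = fibres-bound-Fin encode (t + t)
    (funToFin {suc (suc t)} {2} (λ _ → zero)) nonzero
    λ c ys! ys≡c → fibre-bound {decode c} 1≤t ys!
      (All.map (λ {y} eq a → trans (decode-encode y a) (cong (λ c → decode c a) eq)) ys≡c)
    where
    nonzero : ∀ y → funToFin {suc (suc t)} {2} (λ _ → zero) ≢ encode y
    nonzero y eq with code-nonzero y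
    ... | a , ya = contradiction (begin
      true                                 ≡⟨ ya ⟨
      code y a                             ≡⟨ decode-encode y a ⟩
      decode (encode y) a                  ≡⟨ cong (λ c → decode c a) eq ⟨
      decode (funToFin {suc (suc t)} {2} (λ _ → zero)) a
        ≡⟨ cong unbit (finToFun-funToFin {suc (suc t)} {2} (λ _ → zero) a) ⟩
      false                                ∎) λ ()
      where open ≡-Reasoning

-- Arithmetic of the bound

-- For t = 2 + q this says that 2^(t+2) - (t+4) is at least t + 3 = 5 + q, so the subtraction in the
-- bound is not truncated.
11+2q≤2^[4+q] : ∀ q → 11 + 2 * q ≤ 2 ^ (4 + q)
11+2q≤2^[4+q] zero    = ℕ.m≤m+n 11 5
11+2q≤2^[4+q] (suc q) = begin
  11 + 2 * suc q              ≡⟨ cong (11 +_) (ℕ.*-suc 2 q) ⟩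
  11 + (2 + 2 * q)            ≤⟨ ℕ.m≤m+n _ (9 + 2 * q) ⟩
  11 + (2 + 2 * q) + (9 + 2 * q)
    ≡⟨ solve 1 (λ q → con 11 :+ (con 2 :+ con 2 :* q) :+ (con 9 :+ con 2 :* q) :=
         con 2 :* (con 11 :+ con 2 :* q)) refl q ⟩
  2 * (11 + 2 * q)            ≤⟨ ℕ.*-monoʳ-≤ 2 (11+2q≤2^[4+q] q) ⟩
  2 ^ (5 + q)                 ∎
  where
  open ℕ.≤-Reasoning
  open +-*-Solver

t*[2+t] : ∀ t → t * (2 + t) ≡ suc t ^ 2 ∸ 1
t*[2+t] t = cong (_∸ 1) (solve 1 (λ t → con 1 :+ t :* (con 2 :+ t) :=
  (con 1 :+ t) :* ((con 1 :+ t) :* con 1)) refl t)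
  where open +-*-Solver

excess : ∀ t d → suc t + 3 + d ≡ 2 ^ suc (suc t) → d ≡ 2 ^ (suc t + 1) ∸ suc t ∸ 3
excess t d eq = begin
  d                             ≡⟨ ℕ.m+n∸m≡n (suc t + 3) d ⟨
  suc t + 3 + d ∸ (suc t + 3)   ≡⟨ cong (_∸ (suc t + 3)) eq ⟩
  2 ^ suc (suc t) ∸ (suc t + 3) ≡⟨ cong (λ j → 2 ^ j ∸ (suc t + 3)) (ℕ.+-comm 1 (suc t)) ⟩
  2 ^ (suc t + 1) ∸ (suc t + 3) ≡⟨ ℕ.∸-+-assoc (2 ^ (suc t + 1)) (suc t) 3 ⟨
  2 ^ (suc t + 1) ∸ suc t ∸ 3   ∎
  where open ≡-Reasoning

-- Here `e` is the slack in `11+2q≤2^[4+q]`, so `10 + 2 * q + e` stands for the number of nonzero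
-- codes. The difference of the two sides is a polynomial with nonnegative coefficients, supplied
-- explicitly.
polynomial-≤ : ∀ q e → (10 + 2 * q + e) * ((2 + q) + (2 + q)) ≤
  (2 + q) * (4 + q) * (5 + q + e) + 2 * (3 + q) + 2
polynomial-≤ q e = ℕ.m+n≤o⇒m≤o _ (ℕ.≤-reflexive
  (solve 2 (λ q e → let t = con 2 :+ q in
    (con 10 :+ con 2 :* q :+ e) :* (t :+ t) :+
      (t :* (q :* (con 5 :+ q) :+ t :* e) :+ con 2 :* q :+ con 8) :=
    t :* (con 4 :+ q) :* (con 5 :+ q :+ e) :+ con 2 :* (con 3 :+ q) :+ con 2) refl q e))
  where open +-*-Solver

bound-≤ : ∀ t → 1 ≤ t → (2 ^ suc (suc t) ∸ 1) * (t + t) ≤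
  (suc t ^ 2 ∸ 1) * (2 ^ (suc t + 1) ∸ suc t ∸ 3) + 2 * suc t + 2
-- For the star with two leaves the sides are 14 and 15.
bound-≤ (suc zero)    _ = ℕ.m≤m+n 14 1
bound-≤ (suc (suc q)) _ = from-excess (ℕ.m≤n⇒∃[o]m+o≡n (11+2q≤2^[4+q] q))
  where
  shift : ∀ e → 3 + q + 3 + (5 + q + e) ≡ 11 + 2 * q + e
  shift = solve 2 (λ q e → con 3 :+ q :+ con 3 :+ (con 5 :+ q :+ e) :=
    con 11 :+ con 2 :* q :+ e) refl q
    where open +-*-Solver
  from-excess : (∃ λ e → 11 + 2 * q + e ≡ 2 ^ (4 + q)) → _
  from-excess (e , eq) =
    subst₂ (λ M d → (M ∸ 1) * ((2 + q) + (2 + q)) ≤ d + 2 * (3 + q) + 2) eq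
      (cong₂ _*_ (t*[2+t] (2 + q)) (excess (2 + q) (5 + q + e) (trans (shift e) eq)))
      (polynomial-≤ q e)

theorem4p11 : (t : ℕ) → 2 ≤ t → (n : ℕ) (G : Graph n) →
    InducedSubgraphMinimal G (star t) →
    n ≤ (t ^ 2 ∸ 1) * (2 ^ (t + 1) ∸ t ∸ 3) + 2 * t + 2
theorem4p11 (suc t) (s≤s 1≤t) zero    G minimal = z≤n
theorem4p11 (suc t) (s≤s 1≤t) (suc n) G minimal@((_ , G′ , G≥G′ , G′≅star) , _)
  with pivotMinor⇒↝ G≥G′
... | H , X , f , H↝G , f-emb = ℕ.≤-trans
  -- Composing with the inverse `from` of the isomorphism labels the star in `H` by the vertices of
  -- `star`.
  (vertex-bound minimal H↝G (mk↣ {to = to ∘ from} (from-injective ∘ injective)) (mk≋ star-emb) 1≤t)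
  (bound-≤ t 1≤t)
  where
  open Injection f using (to; injective)
  open _≅_ G′≅star
  open Inverse vertices using (from; inverseˡ) renaming (to to forth)
  from-injective : ∀ {a b} → from a ≡ from b → a ≡ b
  from-injective {a} {b} eq = trans (sym (inverseˡ refl)) (trans (cong forth eq) (inverseˡ refl))
  star-emb : ∀ a b → adj H (to (from a)) (to (from b)) ≡ adj (star (suc t)) a b
  star-emb a b = trans (adj-≡ f-emb (from a) (from b)) (trans (sym (preserve (from a) (from b)))
    (cong₂ (adj (star (suc t))) (inverseˡ refl) (inverseˡ refl)))
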